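{- As $n\to\infty$ through the positive integers, the number of prime numbers in the interval $[4n,5n]$ goes to infinity. That is, for every positive integer $m$ there exists a positive integer $L$ such that for all integers $n\geq L$ there are at least $m$ prime numbers in the interval $[4n,5n]$. -}

module Defs where

open import Data.List using (List; filter; length; upTo)
open import Data.Nat using (ℕ; suc; _≤?_)
open import Data.Nat.Primality using (prime?)

-- upTo (suc b) lists 0, …, b, so both endpoints are included.
interval : ℕ → ℕ → List ℕ
interval a b = filter (a ≤?_) (upTo (suc b))

primesIn : ℕ → ℕ → List ℕ
primesIn a b = filter prime? (interval a b)

#primesIn : ℕ → ℕ → ℕ
#primesIn a b = length (primesIn a b)

{-# OPTIONS --safe #-}
-- Chebyshev's argument. The integer (30N)! N! / ((15N)! (10N)! (6N)!) lies between
-- K^N / (30N + 1) and K^N with K = 2^14 3^9 5^5. By Legendre's formula a prime power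
-- q = p^j contributes to it the exponent ⌊T⌋ + ⌊T/30⌋ - ⌊T/2⌋ - ⌊T/3⌋ - ⌊T/5⌋ ∈ {0, 1}
-- of p, T = 30N/q, which is 0 for T < 1 and 1 for 1 ≤ T < 6. Writing θ x for the product
-- of the primes up to x, this gives θ(30N) ≤ θ(5N) K^N, so by iteration
-- θ(x) ≤ const · K^((11/9) x/30), and K^N ≤ (30N + 1) (30N)^s θ(30N) for s ≥ √(30N).
-- Since 4 · 11/9 < 5, the quotient θ(5n) / θ(4n) grows exponentially in n, whereas each
-- prime in [4n, 5n] contributes at most a factor 5n to it.
module Submission where

open import Defs
open import Data.Bool using (if_then_else_)
open import Data.List using (List; []; _∷_; _++_; [_]; map; length; filter; upTo)
open import Data.List.Properties using (map-++; upTo-∷ʳ; filter-++; filter-accept; length-++)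
open import Data.List.Relation.Binary.Permutation.Propositional.Properties using (map⁺)
open import Data.List.Relation.Binary.Pointwise using (Pointwise; []; _∷_; decidable)
open import Data.List.Relation.Unary.All using (All; []; _∷_)
open import Data.Nat
open import Data.Nat.Divisibility
open import Data.Nat.DivMod
open import Data.Nat.Induction using (<-rec)
open import Data.Nat.ListAction using (product)
open import Data.Nat.ListAction.Properties using (product-++; product-↭)
open import Data.Nat.Primality
open import Data.Nat.Primality.Factorisation using (factorise; module PrimeFactorisation)
open import Data.Nat.Properties
open import Data.Nat.Tactic.RingSolver using (solve-∀)
open import Data.List.Sort.InsertionSort.Base ≤-decTotalOrder using (sort)
open import Data.List.Sort.InsertionSort.Properties ≤-decTotalOrder using (sort-↭)
open import Data.Product using (_×_; _,_; ∃-syntax)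
open import Data.Sum using (inj₁; inj₂)
open import Function using (_∘_; mk⇔)
open import Relation.Binary.PropositionalEquality hiding ([_])
open import Relation.Nullary using (¬_; Dec; does; yes; no; contradiction)
open import Relation.Nullary.Decidable using (True; toWitness; does-⇔; dec-true; dec-false)

-- Finite products and sums over 1 ≤ i ≤ n

∏ ∑ : ℕ → (ℕ → ℕ) → ℕ
∏ zero    f = 1
∏ (suc n) f = f (suc n) * ∏ n f
∑ zero    f = 0
∑ (suc n) f = f (suc n) + ∑ n f

infix 8 ∏ ∑
syntax ∏ n (λ i → t) = ∏[ i ≤ n ] t
syntax ∑ n (λ i → t) = ∑[ i ≤ n ] t

∏-cong : ∀ n {f g} → (∀ {i} → i ≤ n → f i ≡ g i) → ∏ n f ≡ ∏ n g
∏-cong zero    f≗g = refl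
∏-cong (suc n) f≗g = cong₂ _*_ (f≗g ≤-refl) (∏-cong n (f≗g ∘ m≤n⇒m≤1+n))

∏-mono : ∀ n {f g} → (∀ {i} → i ≤ n → f i ≤ g i) → ∏ n f ≤ ∏ n g
∏-mono zero    f≤g = ≤-refl
∏-mono (suc n) f≤g = *-mono-≤ (f≤g ≤-refl) (∏-mono n (f≤g ∘ m≤n⇒m≤1+n))

∏-* : ∀ n f g → ∏[ i ≤ n ] (f i * g i) ≡ ∏ n f * ∏ n g
∏-* zero    f g = refl
∏-* (suc n) f g = trans (cong (f (suc n) * g (suc n) *_) (∏-* n f g))
  ([m*n]*[o*p]≡[m*o]*[n*p] (f (suc n)) (g (suc n)) (∏ n f) (∏ n g))

∏-1 : ∀ n {f} → (∀ {i} → f i ≡ 1) → ∏ n f ≡ 1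
∏-1 zero    f≗1 = refl
∏-1 (suc n) f≗1 = cong₂ _*_ f≗1 (∏-1 n f≗1)

-- Used when a prime is adjoined to a factorisation, which changes the factor at that prime only.
∏-update : ∀ n {f g} c a → .{{NonZero a}} → a ≤ n → (∀ {i} → i ≢ a → g i ≡ f i) →
  g a ≡ c * f a → ∏ n g ≡ c * ∏ n f
∏-update zero    c a a≤0 _ _ = contradiction (n≤0⇒n≡0 a≤0) (≢-nonZero⁻¹ a)
∏-update (suc n) {f} {g} c a a≤1+n g≗f ga≡cfa with a ≟ suc n
... | yes refl = trans
  (cong₂ _*_ ga≡cfa (∏-cong n (λ i≤n → g≗f (<⇒≢ (s≤s i≤n)))))
  (*-assoc c (f (suc n)) (∏ n f))
... | no a≢1+n = trans
  (cong₂ _*_ (g≗f (a≢1+n ∘ sym)) (∏-update n c a (s≤s⁻¹ (≤∧≢⇒< a≤1+n a≢1+n)) g≗f ga≡cfa))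
  (lemma (f (suc n)) c (∏ n f))
  where
  lemma : ∀ x y z → x * (y * z) ≡ y * (x * z)
  lemma = solve-∀

∑-cong : ∀ n {f g} → (∀ i → f i ≡ g i) → ∑ n f ≡ ∑ n g
∑-cong zero    f≗g = refl
∑-cong (suc n) f≗g = cong₂ _+_ (f≗g (suc n)) (∑-cong n f≗g)

∑-mono : ∀ n {f g} → (∀ i → f i ≤ g i) → ∑ n f ≤ ∑ n g
∑-mono zero    f≤g = ≤-refl
∑-mono (suc n) f≤g = +-mono-≤ (f≤g (suc n)) (∑-mono n f≤g)

∑-+ : ∀ n f g → ∑[ i ≤ n ] (f i + g i) ≡ ∑ n f + ∑ n g
∑-+ zero    f g = refl
∑-+ (suc n) f g = trans (cong (f (suc n) + g (suc n) +_) (∑-+ n f g))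
  (lemma (f (suc n)) (g (suc n)) (∑ n f) (∑ n g))
  where
  lemma : ∀ a b c d → (a + b) + (c + d) ≡ (a + c) + (b + d)
  lemma = solve-∀

∑-0 : ∀ n {f} → (∀ i → f i ≡ 0) → ∑ n f ≡ 0
∑-0 zero    f≗0 = refl
∑-0 (suc n) f≗0 = cong₂ _+_ (f≗0 (suc n)) (∑-0 n f≗0)

-- Both sides are f 0 + ... + f n; the end terms are written out because `∑` starts at index 1.
∑-shift : ∀ n {f g} → (∀ i → g (suc i) ≡ f i) → ∑ n g + f n ≡ f 0 + ∑ n f
∑-shift zero    {f} eq = +-comm 0 (f 0)
∑-shift (suc n) {f} {g} eq = begin
  g (suc n) + ∑ n g + f (suc n)  ≡⟨ cong (λ x → x + ∑ n g + f (suc n)) (eq n) ⟩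
  f n + ∑ n g + f (suc n)        ≡⟨ cong (_+ f (suc n)) (+-comm (f n) (∑ n g)) ⟩
  ∑ n g + f n + f (suc n)        ≡⟨ cong (_+ f (suc n)) (∑-shift n eq) ⟩
  f 0 + ∑ n f + f (suc n)        ≡⟨ +-assoc (f 0) _ _ ⟩
  f 0 + (∑ n f + f (suc n))      ≡⟨ cong (f 0 +_) (+-comm (∑ n f) _) ⟩
  f 0 + (f (suc n) + ∑ n f)      ∎
  where open ≡-Reasoning

-- Iverson brackets

opaque
  ⟦_⟧ : ∀ {a} {A : Set a} → Dec A → ℕ
  ⟦ a? ⟧ = if does a? then 1 else 0

  ⟦⟧-true : ∀ {a} {A : Set a} (a? : Dec A) → A → ⟦ a? ⟧ ≡ 1
  ⟦⟧-true a? a rewrite dec-true a? a = refl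

  ⟦⟧-false : ∀ {a} {A : Set a} (a? : Dec A) → ¬ A → ⟦ a? ⟧ ≡ 0
  ⟦⟧-false a? ¬a rewrite dec-false a? ¬a = refl

  ⟦⟧-⇔ : ∀ {a b} {A : Set a} {B : Set b} (a? : Dec A) (b? : Dec B) →
    (A → B) → (B → A) → ⟦ a? ⟧ ≡ ⟦ b? ⟧
  ⟦⟧-⇔ a? b? f g = cong (if_then 1 else 0) (does-⇔ (mk⇔ f g) a? b?)

  ⟦⟧-elim : ∀ {a} {A : Set a} (P : ℕ → Set) (a? : Dec A) → (A → P 1) → (¬ A → P 0) → P ⟦ a? ⟧
  ⟦⟧-elim P (yes a) p₁ p₀ = p₁ a
  ⟦⟧-elim P (no ¬a) p₁ p₀ = p₀ ¬a

-- Unique factorisation as a product over p ≤ X.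

-- Products over primes become products over all p ≤ X in which non-primes contribute 1.
opaque
  primePart : ℕ → ℕ
  primePart p = if does (prime? p) then p else 1

  primePart-prime : ∀ {p} → Prime p → primePart p ≡ p
  primePart-prime {p} pr rewrite dec-true (prime? p) pr = refl

  primePart-¬prime : ∀ {p} → ¬ Prime p → primePart p ≡ 1
  primePart-¬prime {p} ¬pr rewrite dec-false (prime? p) ¬pr = refl

instance
  primePart≢0 : ∀ {p} → NonZero (primePart p)
  primePart≢0 {p} with prime? p
  ... | yes pr = subst NonZero (sym (primePart-prime pr)) (prime⇒nonZero pr)
  ... | no ¬pr = subst NonZero (sym (primePart-¬prime ¬pr)) _

primePart-¬prime-^ : ∀ {p} → ¬ Prime p → ∀ e → primePart p ^ e ≡ 1
primePart-¬prime-^ ¬pr e = trans (cong (_^ e) (primePart-¬prime ¬pr)) (^-zeroˡ e)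

-- For prime `q` and 0 < `k` ≤ `X` this is the exponent of `q` in `k`, counted as the number of j ≥
-- 1 with q^j dividing `k`. The cutoff `X` loses nothing, since q^j > j > X ≥ k for j > X.
multiplicity : ℕ → ℕ → ℕ → ℕ
multiplicity X q k = ∑[ j ≤ X ] ⟦ q ^ j ∣? k ⟧

prime≢⇒∤ : ∀ {p q} → Prime p → Prime q → p ≢ q → ¬ p ∣ q
prime≢⇒∤ pp pq p≢q p∣q with prime⇒irreducible pq p∣q
... | inj₁ refl = ¬prime[1] pp
... | inj₂ p≡q  = p≢q p≡q

-- Euclid's lemma moves one factor `q` at a time into `k`, as `r` offers none.
prime^-cancel : ∀ {q r} → Prime q → ¬ q ∣ r → ∀ j k → q ^ j ∣ r * k → q ^ j ∣ k
prime^-cancel pq q∤r zero    k _ = 1∣ k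
prime^-cancel {q} {r} pq q∤r (suc j) k d
  with euclidsLemma r k pq (∣-trans (m∣m*n (q ^ j)) d)
... | inj₁ q∣r = contradiction q∣r q∤r
... | inj₂ (divides k′ refl) = subst (q * q ^ j ∣_) (*-comm q k′)
  (*-monoʳ-∣ q (prime^-cancel pq q∤r j k′
    (*-cancelˡ-∣ q {{prime⇒nonZero pq}} (subst (q * q ^ j ∣_) (lemma r k′ q) d))))
  where
  lemma : ∀ x y z → x * (y * z) ≡ z * (x * y)
  lemma = solve-∀

n<p^n : ∀ {p} → 2 ≤ p → ∀ n → n < p ^ n
n<p^n 2≤p zero = s≤s z≤n
n<p^n {p} 2≤p (suc n) = begin-strict
  suc n            <⟨ s≤s (n<p^n 2≤p n) ⟩
  suc (p ^ n)      ≤⟨ +-monoˡ-≤ (p ^ n) (≤-trans (s≤s z≤n) (n<p^n 2≤p n)) ⟩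
  p ^ n + p ^ n    ≡⟨ cong (p ^ n +_) (+-identityʳ _) ⟨
  2 * p ^ n        ≤⟨ *-monoˡ-≤ (p ^ n) 2≤p ⟩
  p * p ^ n        ∎
  where open ≤-Reasoning

prime≥2 : ∀ {p} → Prime p → 2 ≤ p
prime≥2 {p} pr = nonTrivial⇒n>1 p {{prime⇒nonTrivial pr}}

multiplicity-1 : ∀ X {q} → Prime q → multiplicity X q 1 ≡ 0
multiplicity-1 zero pq = refl
multiplicity-1 (suc X) {q} pq = cong₂ _+_
  (⟦⟧-false (q ^ suc X ∣? 1) (λ d → <⇒≱ (≤-<-trans (s≤s z≤n) (n<p^n (prime≥2 pq) (suc X))) (∣⇒≤ d)))
  (multiplicity-1 X pq)

multiplicity-≢ : ∀ X {q r} k → Prime q → Prime r → q ≢ r → multiplicity X q (r * k) ≡ multiplicity X q k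
multiplicity-≢ X {q} {r} k pq pr q≢r = ∑-cong X λ j →
  ⟦⟧-⇔ (q ^ j ∣? r * k) (q ^ j ∣? k)
    (prime^-cancel pq (prime≢⇒∤ pq pr q≢r) j k) (∣n⇒∣m*n r)

-- The condition on q^(i+1) for `q * k` is the condition on q^i for `k`. The shift gains i = 0,
-- which always holds, and loses i = X, which fails because q^X > X ≥ k.
multiplicity-≡ : ∀ X {q} k → Prime q → .{{NonZero k}} → k ≤ X →
  multiplicity X q (q * k) ≡ suc (multiplicity X q k)
multiplicity-≡ X {q} k pq k≤X = begin
  multiplicity X q (q * k)                    ≡⟨ +-identityʳ _ ⟨
  multiplicity X q (q * k) + 0                ≡⟨ cong (multiplicity X q (q * k) +_) q^X∤k ⟨
  multiplicity X q (q * k) + ⟦ q ^ X ∣? k ⟧  ≡⟨ ∑-shift X (λ i → ⟦⟧-⇔ (q ^ suc i ∣? q * k) (q ^ i ∣? k)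
                                                    (*-cancelˡ-∣ q {{prime⇒nonZero pq}}) (*-monoʳ-∣ q)) ⟩
  ⟦ 1 ∣? k ⟧ + multiplicity X q k             ≡⟨ cong (_+ multiplicity X q k) (⟦⟧-true (1 ∣? k) (1∣ k)) ⟩
  suc (multiplicity X q k)                    ∎
  where
  open ≡-Reasoning
  q^X∤k : ⟦ q ^ X ∣? k ⟧ ≡ 0
  q^X∤k = ⟦⟧-false (q ^ X ∣? k) λ d → <⇒≱ (≤-<-trans k≤X (n<p^n (prime≥2 pq) X)) (∣⇒≤ d)

-- Exponents matter at primes only, the base being 1 elsewhere.
primePart^-cong : ∀ {e e′ : ℕ} p → (Prime p → e ≡ e′) → primePart p ^ e ≡ primePart p ^ e′
primePart^-cong {e} {e′} p eq with prime? p
... | yes pr = cong (primePart p ^_) (eq pr)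
... | no ¬pr = trans (primePart-¬prime-^ ¬pr e) (sym (primePart-¬prime-^ ¬pr e′))

primePart^-mono : ∀ {e e′ : ℕ} p → (Prime p → e ≤ e′) → primePart p ^ e ≤ primePart p ^ e′
primePart^-mono {e} {e′} p le with prime? p
... | yes pr = ^-monoʳ-≤ (primePart p) (le pr)
... | no ¬pr = ≤-reflexive (trans (primePart-¬prime-^ ¬pr e) (sym (primePart-¬prime-^ ¬pr e′)))

-- Induction on the list of prime factors. The bound by `X` ensures that every prime factor lies in
-- the index range and that no power is cut off.
∏-product : ∀ X as → All Prime as → product as ≤ X →
  ∏[ p ≤ X ] (primePart p ^ multiplicity X p (product as)) ≡ product as
∏-product X [] [] _ = ∏-1 X λ {p} →
  primePart^-cong p (multiplicity-1 X)
∏-product X (a ∷ as) (pa ∷ ps) a*k≤X =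
  trans (∏-update X a a (≤-trans (m≤m*n a k) a*k≤X) other same)
        (cong (a *_) (∏-product X as ps k≤X))
  where
  k = product as
  instance
    k≢0 : NonZero k
    k≢0 = productOfPrimes≢0 ps
    a≢0 : NonZero a
    a≢0 = prime⇒nonZero pa
  k≤X : k ≤ X
  k≤X = ≤-trans (m≤n*m k a) a*k≤X
  other : ∀ {p} → p ≢ a → primePart p ^ multiplicity X p (a * k) ≡ primePart p ^ multiplicity X p k
  other {p} p≢a = primePart^-cong p λ pp → multiplicity-≢ X k pp pa p≢a
  same : primePart a ^ multiplicity X a (a * k) ≡ a * primePart a ^ multiplicity X a k
  same rewrite primePart-prime pa = cong (a ^_) (multiplicity-≡ X k pa k≤X)

∏-multiplicity : ∀ X k → .{{NonZero k}} → k ≤ X → ∏[ p ≤ X ] (primePart p ^ multiplicity X p k) ≡ k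
∏-multiplicity X k k≤X =
  subst (λ m → ∏[ p ≤ X ] (primePart p ^ multiplicity X p m) ≡ m) (sym isFactorisation)
    (∏-product X factors factorsPrime (subst (_≤ X) isFactorisation k≤X))
  where open PrimeFactorisation (factorise k)

-- Floor division and Legendre's formula

/-unique : ∀ {m} a d .{{_ : NonZero d}} → a * d ≤ m → m < suc a * d → m / d ≡ a
/-unique {m} a d lo hi = ≤-antisym
  (s≤s⁻¹ (m<n*o⇒m/o<n hi))
  (subst (_≤ m / d) (m*n/n≡m a d) (/-monoˡ-≤ d lo))

m<1+m/n*n : ∀ m n .{{_ : NonZero n}} → m < suc (m / n) * n
m<1+m/n*n m n = begin-strict
  m                    ≡⟨ m≡m%n+[m/n]*n m n ⟩
  m % n + m / n * n    <⟨ +-monoˡ-< (m / n * n) (m%n<n m n) ⟩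
  n + m / n * n        ∎
  where open ≤-Reasoning

suc-/ : ∀ n d .{{_ : NonZero d}} → suc n / d ≡ ⟦ d ∣? suc n ⟧ + n / d
suc-/ n d = ⟦⟧-elim (λ x → suc n / d ≡ x + n / d) (d ∣? suc n) divisible indivisible
  where
  divisible : d ∣ suc n → suc n / d ≡ 1 + n / d
  divisible (divides c 1+n≡cd) = trans (cong (_/ d) 1+n≡cd) (trans (m*n/n≡m c d) (≤-antisym
    (*-cancelʳ-≤ c (suc (n / d)) d (subst (_≤ suc (n / d) * d) 1+n≡cd (m<1+m/n*n n d)))
    (*-cancelʳ-< d (n / d) c (≤-<-trans (m/n*n≤m n d) (subst (n <_) 1+n≡cd ≤-refl)))))
  indivisible : ¬ d ∣ suc n → suc n / d ≡ n / d
  indivisible d∤1+n = /-unique (n / d) d (m≤n⇒m≤1+n (m/n*n≤m n d))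
    (≤∧≢⇒< (m<1+m/n*n n d) λ eq → d∤1+n (divides (suc (n / d)) eq))

-- Legendre's expression for the exponent of a prime `q` in `n !`, complete once n ≤ X.
legendre : ℕ → (q : ℕ) → .{{NonZero q}} → ℕ → ℕ
legendre X q n = ∑[ j ≤ X ] ((n / q ^ j) {{m^n≢0 q j}})

legendre-suc : ∀ X q .{{_ : NonZero q}} n → legendre X q (suc n) ≡ multiplicity X q (suc n) + legendre X q n
legendre-suc X q n = trans (∑-cong X λ j → suc-/ n (q ^ j) {{m^n≢0 q j}}) (∑-+ X _ _)

-- Division by powers of the base needs a nonzero base. `primePart p` is nonzero for every `p` and
-- agrees with `p` at primes, so it replaces `p` inside the exponents.
multiplicity-primePart : ∀ X k p →
  primePart p ^ multiplicity X (primePart p) k ≡ primePart p ^ multiplicity X p k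
multiplicity-primePart X k p =
  primePart^-cong p λ pr → cong (λ q → multiplicity X q k) (primePart-prime pr)

-- Induction on `n` with `X` fixed: factorising `suc n` adds its multiplicities to the exponents.
-- The common `X` lets different factorials be compared factor by factor.
!-legendre : ∀ X n → n ≤ X → n ! ≡ ∏[ p ≤ X ] (primePart p ^ legendre X (primePart p) n)
!-legendre X zero _ = sym (∏-1 X λ {p} →
  cong (primePart p ^_) (∑-0 X λ j → 0/n≡0 (primePart p ^ j) {{m^n≢0 (primePart p) j}}))
!-legendre X (suc n) n<X = begin
  suc n * n !
    ≡⟨ cong₂ _*_ (sym (∏-multiplicity X (suc n) n<X)) (!-legendre X n (<⇒≤ n<X)) ⟩
  ∏[ p ≤ X ] (primePart p ^ multiplicity X p (suc n)) * ∏[ p ≤ X ] (primePart p ^ legendre X (primePart p) n)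
    ≡⟨ ∏-* X _ _ ⟨
  ∏[ p ≤ X ] (primePart p ^ multiplicity X p (suc n) * primePart p ^ legendre X (primePart p) n)
    ≡⟨ ∏-cong X (λ {p} _ → begin
      primePart p ^ multiplicity X p (suc n) * primePart p ^ legendre X (primePart p) n
        ≡⟨ cong (_* primePart p ^ legendre X (primePart p) n) (multiplicity-primePart X (suc n) p) ⟨
      primePart p ^ multiplicity X (primePart p) (suc n) * primePart p ^ legendre X (primePart p) n
        ≡⟨ ^-distribˡ-+-* (primePart p) (multiplicity X (primePart p) (suc n)) _ ⟨
      primePart p ^ (multiplicity X (primePart p) (suc n) + legendre X (primePart p) n)
        ≡⟨ cong (primePart p ^_) (legendre-suc X (primePart p) n) ⟨
      primePart p ^ legendre X (primePart p) (suc n) ∎) ⟩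
  ∏[ p ≤ X ] (primePart p ^ legendre X (primePart p) (suc n)) ∎
  where open ≡-Reasoning

-- Chebyshev's factorial ratio
/-periodic : ∀ c k t a .{{_ : NonZero c}} → (t + a * (k * c)) / c ≡ t / c + a * k
/-periodic c k t a = trans
  (+-distrib-/-∣ʳ t (divides (a * k) (sym (*-assoc a k c))))
  (cong (t / c +_) (trans (cong (_/ c) (sym (*-assoc a k c))) (m*n/n≡m (a * k) c)))

-- Since 15 + 10 + 6 = 31 = 30 + 1, this sum and the one in `chebyshev-periodic₂` grow equally over
-- a period of 30. Comparing them is thus a finite check on residues.
chebyshev-periodic₃ : ∀ t a → let T = t + a * 30 in
  T / 2 + T / 3 + T / 5 ≡ t / 2 + t / 3 + t / 5 + a * 31
chebyshev-periodic₃ t a = trans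
  (cong₂ _+_ (cong₂ _+_ (/-periodic 2 15 t a) (/-periodic 3 10 t a)) (/-periodic 5 6 t a))
  (lemma (t / 2) (t / 3) (t / 5) a)
  where
  lemma : ∀ x y z a → (x + a * 15) + (y + a * 10) + (z + a * 6) ≡ x + y + z + a * 31
  lemma = solve-∀

chebyshev-periodic₂ : ∀ t a → let T = t + a * 30 in T + T / 30 ≡ t + t / 30 + a * 31
chebyshev-periodic₂ t a = trans (cong (t + a * 30 +_) (/-periodic 30 1 t a)) (lemma t (t / 30) a)
  where
  lemma : ∀ x y a → (x + a * 30) + (y + a * 1) ≡ x + y + a * 31
  lemma = solve-∀

chebyshev-lower-30 : ∀ {t} → t < 30 → t / 2 + t / 3 + t / 5 ≤ t + t / 30
chebyshev-lower-30 = toWitness {a? = allUpTo? (λ t → t / 2 + t / 3 + t / 5 ≤? t + t / 30) 30} _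

chebyshev-upper-30 : ∀ {t} → t < 30 → t + t / 30 ≤ 1 + (t / 2 + t / 3 + t / 5)
chebyshev-upper-30 = toWitness {a? = allUpTo? (λ t → t + t / 30 ≤? 1 + (t / 2 + t / 3 + t / 5)) 30} _

chebyshev-first-5 : ∀ {t} → t < 5 → let T = suc t in 1 + (T / 2 + T / 3 + T / 5) ≤ T + T / 30
chebyshev-first-5 = toWitness {a? = allUpTo? (λ t → let T = suc t in 1 + (T / 2 + T / 3 + T / 5) ≤? T + T / 30) 5} _

chebyshev-lower : ∀ T → T / 2 + T / 3 + T / 5 ≤ T + T / 30
chebyshev-lower T = subst (λ T → T / 2 + T / 3 + T / 5 ≤ T + T / 30) (sym (m≡m%n+[m/n]*n T 30))
  (subst₂ _≤_ (sym (chebyshev-periodic₃ t a)) (sym (chebyshev-periodic₂ t a))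
    (+-monoˡ-≤ (a * 31) (chebyshev-lower-30 (m%n<n T 30))))
  where
  t = T % 30
  a = T / 30

chebyshev-upper : ∀ T → T + T / 30 ≤ 1 + (T / 2 + T / 3 + T / 5)
chebyshev-upper T = subst (λ T → T + T / 30 ≤ 1 + (T / 2 + T / 3 + T / 5)) (sym (m≡m%n+[m/n]*n T 30))
  (subst₂ (λ x y → x ≤ 1 + y) (sym (chebyshev-periodic₂ t a)) (sym (chebyshev-periodic₃ t a))
    (+-monoˡ-≤ (a * 31) (chebyshev-upper-30 (m%n<n T 30))))
  where
  t = T % 30
  a = T / 30

chebyshev-first : ∀ T → 1 ≤ T → T < 6 → 1 + (T / 2 + T / 3 + T / 5) ≤ T + T / 30
chebyshev-first (suc T) _ T<6 = chebyshev-first-5 (s≤s⁻¹ T<6)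

-- With c * k = 30, this expresses all the quotients by `d` through the single number T = ⌊30N/d⌋.
/-nested : ∀ c k N d .{{_ : NonZero c}} .{{_ : NonZero d}} → (c * k) * N / d / c ≡ k * N / d
/-nested c k N d = trans
  (cong (λ m → m / d / c) (trans (*-assoc c k N) (*-comm c (k * N))))
  (trans (m/n/o≡m/[n*o] (k * N * c) d c) (m*n/o*n≡m/o (k * N) c d))
  where instance _ = m*n≢0 d c

module _ (N d : ℕ) .{{_ : NonZero d}} where
  private T = 30 * N / d

  quotients₃ : 15 * N / d + 10 * N / d + 6 * N / d ≡ T / 2 + T / 3 + T / 5
  quotients₃ = sym (cong₂ _+_ (cong₂ _+_ (/-nested 2 15 N d) (/-nested 3 10 N d)) (/-nested 5 6 N d))

  quotients₂ : 30 * N / d + N / d ≡ T + T / 30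
  quotients₂ = sym (cong (T +_) (trans (/-nested 30 1 N d) (cong (_/ d) (*-identityˡ N))))

  quotients-lower : 15 * N / d + 10 * N / d + 6 * N / d ≤ 30 * N / d + N / d
  quotients-lower = subst₂ _≤_ (sym quotients₃) (sym quotients₂) (chebyshev-lower T)

  quotients-upper : 30 * N / d + N / d ≤ 15 * N / d + 10 * N / d + 6 * N / d + ⟦ d ≤? 30 * N ⟧
  quotients-upper = ⟦⟧-elim (λ x → 30 * N / d + N / d ≤ 15 * N / d + 10 * N / d + 6 * N / d + x) (d ≤? 30 * N)
    (λ _ → subst₂ _≤_ (sym quotients₂) (trans (+-comm 1 _) (cong (_+ 1) (sym quotients₃))) (chebyshev-upper T))
    (λ d≰30N → ≤-trans
      (≤-reflexive (cong₂ _+_ (m<n⇒m/n≡0 (≰⇒> d≰30N)) (m<n⇒m/n≡0 (≤-<-trans (m≤n*m N 30) (≰⇒> d≰30N)))))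
      z≤n)

  -- For 5N < d ≤ 30N the number T lies in {1, ..., 5}, where the difference of the two sums is 1.
  quotients-first : d ≤ 30 * N →
    ⟦ 5 * N <? d ⟧ + (15 * N / d + 10 * N / d + 6 * N / d) ≤ 30 * N / d + N / d
  quotients-first d≤30N = ⟦⟧-elim (λ x → x + (15 * N / d + 10 * N / d + 6 * N / d) ≤ 30 * N / d + N / d) (5 * N <? d)
    (λ 5N<d → subst₂ _≤_ (cong (1 +_) (sym quotients₃)) (sym quotients₂)
      (chebyshev-first T (m≥n⇒m/n>0 d≤30N)
        (m<n*o⇒m/o<n (subst (_< 6 * d) (sym (*-assoc 6 5 N)) (*-monoʳ-< 6 5N<d)))))
    (λ _ → quotients-lower)

-- Meant for sums over prime powers: the surplus `c` comes from the first power, the prime itself.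
∑-mono-+ : ∀ n {f g} c → (∀ i → f i ≤ g i) → c + f 1 ≤ g 1 → c + ∑ (suc n) f ≤ ∑ (suc n) g
∑-mono-+ zero {f} {g} c f≤g cf≤g =
  subst₂ _≤_ (cong (c +_) (sym (+-identityʳ (f 1)))) (sym (+-identityʳ (g 1))) cf≤g
∑-mono-+ (suc n) {f} {g} c f≤g cf≤g = begin
  c + (f (2 + n) + ∑ (suc n) f)  ≡⟨ lemma c (f (2 + n)) (∑ (suc n) f) ⟩
  f (2 + n) + (c + ∑ (suc n) f)  ≤⟨ +-mono-≤ (f≤g (2 + n)) (∑-mono-+ n c f≤g cf≤g) ⟩
  g (2 + n) + ∑ (suc n) g        ∎
  where
  open ≤-Reasoning
  lemma : ∀ x y z → x + (y + z) ≡ y + (x + z)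
  lemma = solve-∀

module _ (X N q : ℕ) .{{_ : NonZero q}} where

  ∑-quotients₃ : ∑[ j ≤ X ] ((15 * N / q ^ j) {{m^n≢0 q j}} + (10 * N / q ^ j) {{m^n≢0 q j}} + (6 * N / q ^ j) {{m^n≢0 q j}})
    ≡ legendre X q (15 * N) + legendre X q (10 * N) + legendre X q (6 * N)
  ∑-quotients₃ = trans (∑-+ X _ _) (cong (_+ legendre X q (6 * N)) (∑-+ X _ _))

  ∑-quotients₂ : ∑[ j ≤ X ] ((30 * N / q ^ j) {{m^n≢0 q j}} + (N / q ^ j) {{m^n≢0 q j}})
    ≡ legendre X q (30 * N) + legendre X q N
  ∑-quotients₂ = ∑-+ X _ _

  legendre-upper : legendre X q (30 * N) + legendre X q N
    ≤ legendre X q (15 * N) + legendre X q (10 * N) + legendre X q (6 * N) + ∑[ j ≤ X ] ⟦ q ^ j ≤? 30 * N ⟧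
  legendre-upper = subst₂ _≤_ ∑-quotients₂
    (trans (∑-+ X _ _) (cong (_+ ∑[ j ≤ X ] ⟦ q ^ j ≤? 30 * N ⟧) ∑-quotients₃))
    (∑-mono X λ j → quotients-upper N (q ^ j) {{m^n≢0 q j}})

legendre-lower : ∀ X .{{_ : NonZero X}} N p .{{_ : NonZero p}} → p ≤ 30 * N →
  ⟦ 5 * N <? p ⟧ + (legendre X p (15 * N) + legendre X p (10 * N) + legendre X p (6 * N))
    ≤ legendre X p (30 * N) + legendre X p N
legendre-lower (suc x) N p p≤30N = subst₂ _≤_ (cong (⟦ 5 * N <? p ⟧ +_) (∑-quotients₃ (suc x) N p)) (∑-quotients₂ (suc x) N p)
  (∑-mono-+ x ⟦ 5 * N <? p ⟧ (λ j → quotients-lower N (p ^ j) {{m^n≢0 p j}})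
    -- The term at index 1 has the divisor `p ^ 1`, which unfolds to `p * 1`.
    (subst (λ d → .{{_ : NonZero d}} → ⟦ 5 * N <? p ⟧ + (15 * N / d + 10 * N / d + 6 * N / d) ≤ 30 * N / d + N / d)
      (sym (*-identityʳ p)) (quotients-first N p p≤30N) {{m^n≢0 p 1}}))

-- Chebyshev's ratio is kept as a pair, and every estimate of it is stated with denominators
-- cleared.
numerator denominator : ℕ → ℕ
numerator   N = (30 * N) ! * N !
denominator N = (15 * N) ! * (10 * N) ! * (6 * N) !

∏-primePart-* : ∀ X (e e′ : ℕ → ℕ) → ∏[ p ≤ X ] (primePart p ^ (e p + e′ p))
  ≡ ∏[ p ≤ X ] (primePart p ^ e p) * ∏[ p ≤ X ] (primePart p ^ e′ p)
∏-primePart-* X e e′ = trans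
  (∏-cong X λ {p} _ → ^-distribˡ-+-* (primePart p) (e p) (e′ p))
  (∏-* X (λ p → primePart p ^ e p) (λ p → primePart p ^ e′ p))

module _ (N : ℕ) where
  private
    X = 30 * N
    l : ℕ → ℕ → ℕ
    l n p = legendre X (primePart p) n

  numerator-legendre : numerator N ≡ ∏[ p ≤ X ] (primePart p ^ (l (30 * N) p + l N p))
  numerator-legendre = trans
    (cong₂ _*_ (!-legendre X X ≤-refl) (!-legendre X N (m≤n*m N 30)))
    (sym (∏-primePart-* X (l (30 * N)) (l N)))

  denominator-legendre : denominator N ≡ ∏[ p ≤ X ] (primePart p ^ (l (15 * N) p + l (10 * N) p + l (6 * N) p))
  denominator-legendre = trans
    (cong₂ _*_
      (trans (cong₂ _*_ (!-legendre X (15 * N) (≤X 15 (toWitness {a? = 15 ≤? 30} _)))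
                        (!-legendre X (10 * N) (≤X 10 (toWitness {a? = 10 ≤? 30} _))))
             (sym (∏-primePart-* X (l (15 * N)) (l (10 * N)))))
      (!-legendre X (6 * N) (≤X 6 (toWitness {a? = 6 ≤? 30} _))))
    (sym (∏-primePart-* X (λ p → l (15 * N) p + l (10 * N) p) (l (6 * N))))
    where
    ≤X : ∀ c → c ≤ 30 → c * N ≤ X
    ≤X c c≤30 = *-monoˡ-≤ N c≤30

  -- At each prime the ratio has at most one factor for every power of that prime up to 30N.
  numerator-upper : numerator N ≤ denominator N * ∏[ p ≤ X ] (primePart p ^ ∑[ j ≤ X ] ⟦ primePart p ^ j ≤? X ⟧)
  numerator-upper = begin
    numerator N
      ≡⟨ numerator-legendre ⟩
    ∏[ p ≤ X ] (primePart p ^ (l (30 * N) p + l N p))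
      ≤⟨ ∏-mono X (λ {p} _ → ^-monoʳ-≤ (primePart p) (legendre-upper X N (primePart p))) ⟩
    ∏[ p ≤ X ] (primePart p ^ (l (15 * N) p + l (10 * N) p + l (6 * N) p + ∑[ j ≤ X ] ⟦ primePart p ^ j ≤? X ⟧))
      ≡⟨ ∏-primePart-* X (λ p → l (15 * N) p + l (10 * N) p + l (6 * N) p) (λ p → ∑[ j ≤ X ] ⟦ primePart p ^ j ≤? X ⟧) ⟩
    ∏[ p ≤ X ] (primePart p ^ (l (15 * N) p + l (10 * N) p + l (6 * N) p)) * Ψ
      ≡⟨ cong (_* Ψ) denominator-legendre ⟨
    denominator N * Ψ ∎
    where
    open ≤-Reasoning
    Ψ = ∏[ p ≤ X ] (primePart p ^ ∑[ j ≤ X ] ⟦ primePart p ^ j ≤? X ⟧)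

  -- Every prime in (5N, 30N] survives in the ratio, and no prime has a negative exponent.
  numerator-lower : ∏[ p ≤ X ] (primePart p ^ ⟦ 5 * N <? p ⟧) * denominator N ≤ numerator N
  numerator-lower = begin
    Θ * denominator N
      ≡⟨ cong (Θ *_) denominator-legendre ⟩
    Θ * ∏[ p ≤ X ] (primePart p ^ (l (15 * N) p + l (10 * N) p + l (6 * N) p))
      ≡⟨ ∏-primePart-* X (λ p → ⟦ 5 * N <? p ⟧) (λ p → l (15 * N) p + l (10 * N) p + l (6 * N) p) ⟨
    ∏[ p ≤ X ] (primePart p ^ (⟦ 5 * N <? p ⟧ + (l (15 * N) p + l (10 * N) p + l (6 * N) p)))
      ≤⟨ ∏-mono X (λ {p} p≤X → primePart^-mono p (exponent p p≤X)) ⟩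
    ∏[ p ≤ X ] (primePart p ^ (l (30 * N) p + l N p))
      ≡⟨ numerator-legendre ⟨
    numerator N ∎
    where
    open ≤-Reasoning
    Θ = ∏[ p ≤ X ] (primePart p ^ ⟦ 5 * N <? p ⟧)
    exponent : ∀ p → p ≤ X → Prime p →
      ⟦ 5 * N <? p ⟧ + (l (15 * N) p + l (10 * N) p + l (6 * N) p) ≤ l (30 * N) p + l N p
    exponent p p≤X pr = subst
      (λ q → ⟦ 5 * N <? q ⟧ + (l (15 * N) p + l (10 * N) p + l (6 * N) p) ≤ l (30 * N) p + l N p)
      (primePart-prime pr)
      (legendre-lower X {{>-nonZero (≤-trans (>-nonZero⁻¹ p {{prime⇒nonZero pr}}) p≤X)}} N (primePart p)
        (subst (_≤ X) (sym (primePart-prime pr)) p≤X))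

-- Growth of the ratio
shiftedProduct : ℕ → List ℕ → ℕ
shiftedProduct y l = product (map (y +_) l)

shiftedProduct-++ : ∀ y l l′ → shiftedProduct y (l ++ l′) ≡ shiftedProduct y l * shiftedProduct y l′
shiftedProduct-++ y l l′ = trans (cong product (map-++ (y +_) l l′)) (product-++ (map (y +_) l) (map (y +_) l′))

shiftedProduct-mono : ∀ y {l l′} → Pointwise _≤_ l l′ → shiftedProduct y l ≤ shiftedProduct y l′
shiftedProduct-mono y []           = ≤-refl
shiftedProduct-mono y (a≤b ∷ l≤l′) = *-mono-≤ (+-monoʳ-≤ y a≤b) (shiftedProduct-mono y l≤l′)

shiftedProduct-sort : ∀ y l → shiftedProduct y (sort l) ≡ shiftedProduct y l
shiftedProduct-sort y l = product-↭ (map⁺ (y +_) (sort-↭ l))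

-- Sorting both lists pairs every factor y + i with a factor y + j such that i ≤ j.
shiftedProduct-≤ : ∀ l l′ {_ : True (decidable _≤?_ (sort l) (sort l′))} y → shiftedProduct y l ≤ shiftedProduct y l′
shiftedProduct-≤ l l′ {t} y = subst₂ _≤_ (shiftedProduct-sort y l) (shiftedProduct-sort y l′)
  (shiftedProduct-mono y (toWitness t))

multiples : ℕ → ℕ → List ℕ
multiples k zero    = []
multiples k (suc c) = k * suc c ∷ multiples k c

[c+m]! : ∀ c k m → (c + m) ! * k ^ c ≡ m ! * shiftedProduct (k * m) (multiples k c)
[c+m]! zero    k m = refl
[c+m]! (suc c) k m = begin
  suc (c + m) * (c + m) ! * (k * k ^ c)    ≡⟨ lemma₁ c k m ((c + m) !) (k ^ c) ⟩
  (k * m + k * suc c) * ((c + m) ! * k ^ c) ≡⟨ cong ((k * m + k * suc c) *_) ([c+m]! c k m) ⟩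
  (k * m + k * suc c) * (m ! * P)          ≡⟨ lemma₂ (k * m + k * suc c) (m !) P ⟩
  m ! * ((k * m + k * suc c) * P)          ∎
  where
  open ≡-Reasoning
  P = shiftedProduct (k * m) (multiples k c)
  lemma₁ : ∀ c k m f e → suc (c + m) * f * (k * e) ≡ (k * m + k * suc c) * (f * e)
  lemma₁ = solve-∀
  lemma₂ : ∀ a b c → a * (b * c) ≡ b * (a * c)
  lemma₂ = solve-∀

[c*1+n]! : ∀ c k n → (c * suc n) ! * k ^ c ≡ (c * n) ! * shiftedProduct (k * c * n) (multiples k c)
[c*1+n]! c k n = trans (cong (λ m → m ! * k ^ c) (*-suc c n)) (trans ([c+m]! c k (c * n))
  (cong (λ y → (c * n) ! * shiftedProduct y (multiples k c)) (sym (*-assoc k c n))))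

-- Passing from n to n + 1 multiplies the factorials by products of terms 30 n + i,
-- after k * (c n + i) = 30 n + k i has been used to clear the multipliers k.
numeratorOffsets denominatorOffsets : List ℕ
numeratorOffsets   = multiples 1 30 ++ multiples 30 1
denominatorOffsets = (multiples 2 15 ++ multiples 3 10) ++ multiples 5 6

numerator-suc : ∀ n → numerator (suc n) * 30 ≡ numerator n * shiftedProduct (30 * n) numeratorOffsets
numerator-suc n = begin
  (30 * suc n) ! * suc n ! * 30
    ≡⟨ *-assoc ((30 * suc n) !) (suc n !) 30 ⟩
  (30 * suc n) ! * (suc n ! * 30)
    ≡⟨ cong₂ _*_ (trans (sym (*-identityʳ ((30 * suc n) !))) ([c*1+n]! 30 1 n))
         (subst₂ (λ a b → a ! * 30 ≡ b ! * S₂) (*-identityˡ (suc n)) (*-identityˡ n) ([c*1+n]! 1 30 n)) ⟩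
  ((30 * n) ! * S₁) * (n ! * S₂)
    ≡⟨ [m*n]*[o*p]≡[m*o]*[n*p] ((30 * n) !) S₁ (n !) S₂ ⟩
  numerator n * (S₁ * S₂)
    ≡⟨ cong (numerator n *_) (shiftedProduct-++ (30 * n) (multiples 1 30) (multiples 30 1)) ⟨
  numerator n * shiftedProduct (30 * n) numeratorOffsets ∎
  where
  open ≡-Reasoning
  S₁ = shiftedProduct (30 * n) (multiples 1 30)
  S₂ = shiftedProduct (30 * n) (multiples 30 1)

denominator-suc : ∀ n → denominator (suc n) * (2 ^ 15 * 3 ^ 10 * 5 ^ 6)
  ≡ denominator n * shiftedProduct (30 * n) denominatorOffsets
denominator-suc n = begin
  denominator (suc n) * (2 ^ 15 * 3 ^ 10 * 5 ^ 6)
    ≡⟨ interchange ((15 * suc n) !) ((10 * suc n) !) ((6 * suc n) !) (2 ^ 15) (3 ^ 10) (5 ^ 6) ⟩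
  ((15 * suc n) ! * 2 ^ 15) * ((10 * suc n) ! * 3 ^ 10) * ((6 * suc n) ! * 5 ^ 6)
    ≡⟨ cong₂ _*_ (cong₂ _*_ ([c*1+n]! 15 2 n) ([c*1+n]! 10 3 n)) ([c*1+n]! 6 5 n) ⟩
  ((15 * n) ! * S₁) * ((10 * n) ! * S₂) * ((6 * n) ! * S₃)
    ≡⟨ interchange ((15 * n) !) ((10 * n) !) ((6 * n) !) S₁ S₂ S₃ ⟨
  denominator n * (S₁ * S₂ * S₃)
    ≡⟨ cong (denominator n *_) (trans
         (shiftedProduct-++ (30 * n) (multiples 2 15 ++ multiples 3 10) (multiples 5 6))
         (cong (_* S₃) (shiftedProduct-++ (30 * n) (multiples 2 15) (multiples 3 10)))) ⟨
  denominator n * shiftedProduct (30 * n) denominatorOffsets ∎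
  where
  open ≡-Reasoning
  S₁ = shiftedProduct (30 * n) (multiples 2 15)
  S₂ = shiftedProduct (30 * n) (multiples 3 10)
  S₃ = shiftedProduct (30 * n) (multiples 5 6)
  interchange : ∀ a b c u v w → a * b * c * (u * v * w) ≡ (a * u) * (b * v) * (c * w)
  interchange = solve-∀

opaque
  -- Equal to 30^30 / (15^15 10^10 6^6), the exponential growth rate of the ratio by Stirling's
  -- formula. Opaque, so that its powers stay symbolic.
  K : ℕ
  K = 2 ^ 14 * 3 ^ 9 * 5 ^ 5

  K*30 : K * 30 ≡ 2 ^ 15 * 3 ^ 10 * 5 ^ 6
  K*30 = refl

  K≥2 : 2 ≤ K
  K≥2 = ≤ᵇ⇒≤ 2 K _

offsets-upper : ∀ y → shiftedProduct y numeratorOffsets ≤ shiftedProduct y denominatorOffsets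
offsets-upper = shiftedProduct-≤ numeratorOffsets denominatorOffsets

-- Adjoining 1 to the denominator offsets and 30 to the numerator offsets reverses the domination
-- between the sorted lists.
offsets-lower : ∀ y → (y + 1) * shiftedProduct y denominatorOffsets ≤ (y + 30) * shiftedProduct y numeratorOffsets
offsets-lower = shiftedProduct-≤ (1 ∷ denominatorOffsets) (30 ∷ numeratorOffsets)

K^suc : ∀ n → K ^ suc n * denominator (suc n) * 30 ≡ K ^ n * denominator n * shiftedProduct (30 * n) denominatorOffsets
K^suc n = begin
  K * K ^ n * denominator (suc n) * 30                      ≡⟨ lemma K (K ^ n) (denominator (suc n)) 30 ⟩
  K ^ n * (denominator (suc n) * (K * 30))                  ≡⟨ cong (λ x → K ^ n * (denominator (suc n) * x)) K*30 ⟩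
  K ^ n * (denominator (suc n) * (2 ^ 15 * 3 ^ 10 * 5 ^ 6)) ≡⟨ cong (K ^ n *_) (denominator-suc n) ⟩
  K ^ n * (denominator n * S)                               ≡⟨ *-assoc (K ^ n) (denominator n) S ⟨
  K ^ n * denominator n * S                                 ∎
  where
  open ≡-Reasoning
  S = shiftedProduct (30 * n) denominatorOffsets
  lemma : ∀ k e d c → k * e * d * c ≡ e * (d * (k * c))
  lemma = solve-∀

numerator≤K^ : ∀ n → numerator n ≤ K ^ n * denominator n
numerator≤K^ zero    = ≤-refl
numerator≤K^ (suc n) = *-cancelʳ-≤ _ _ 30 (begin
  numerator (suc n) * 30                                              ≡⟨ numerator-suc n ⟩
  numerator n * shiftedProduct (30 * n) numeratorOffsets              ≤⟨ *-mono-≤ (numerator≤K^ n) (offsets-upper (30 * n)) ⟩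
  K ^ n * denominator n * shiftedProduct (30 * n) denominatorOffsets  ≡⟨ K^suc n ⟨
  K ^ suc n * denominator (suc n) * 30                                ∎)
  where open ≤-Reasoning

-- Step `n` loses a factor (30n + 30) / (30n + 1), at most (30(n + 1) + 1) / (30n + 1); these bounds
-- telescope.
K^≤numerator : ∀ n → K ^ n * denominator n ≤ (30 * n + 1) * numerator n
K^≤numerator zero    = ≤-refl
K^≤numerator (suc n) = *-cancelʳ-≤ _ _ 30 (begin
  K ^ suc n * denominator (suc n) * 30      ≡⟨ K^suc n ⟩
  K ^ n * denominator n * S                 ≤⟨ *-monoˡ-≤ S (K^≤numerator n) ⟩
  (30 * n + 1) * numerator n * S            ≡⟨ lemma₁ (30 * n + 1) (numerator n) S ⟩
  numerator n * ((30 * n + 1) * S)          ≤⟨ *-monoʳ-≤ (numerator n) (offsets-lower (30 * n)) ⟩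
  numerator n * ((30 * n + 30) * S′)        ≡⟨ lemma₂ (30 * n + 30) (numerator n) S′ ⟨
  (30 * n + 30) * (numerator n * S′)        ≡⟨ cong ((30 * n + 30) *_) (numerator-suc n) ⟨
  (30 * n + 30) * (numerator (suc n) * 30)  ≤⟨ *-monoˡ-≤ (numerator (suc n) * 30) 30n+30≤ ⟩
  (30 * suc n + 1) * (numerator (suc n) * 30) ≡⟨ *-assoc (30 * suc n + 1) (numerator (suc n)) 30 ⟨
  (30 * suc n + 1) * numerator (suc n) * 30 ∎)
  where
  open ≤-Reasoning
  S  = shiftedProduct (30 * n) denominatorOffsets
  S′ = shiftedProduct (30 * n) numeratorOffsets
  30n+30≤ : 30 * n + 30 ≤ 30 * suc n + 1
  30n+30≤ = ≤-trans (≤-reflexive (trans (+-comm (30 * n) 30) (sym (*-suc 30 n)))) (m≤m+n (30 * suc n) 1)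
  lemma₁ : ∀ a b c → a * b * c ≡ b * (a * c)
  lemma₁ = solve-∀
  lemma₂ : ∀ a b c → a * (b * c) ≡ b * (a * c)
  lemma₂ = solve-∀

^-* : ∀ m n o → (m * n) ^ o ≡ m ^ o * n ^ o
^-* m n zero    = refl
^-* m n (suc o) = trans (cong (m * n *_) (^-* m n o)) ([m*n]*[o*p]≡[m*o]*[n*p] m n (m ^ o) (n ^ o))

∏≢0 : ∀ n {f} → (∀ {i} → NonZero (f i)) → NonZero (∏ n f)
∏≢0 zero    f≢0 = _
∏≢0 (suc n) f≢0 = m*n≢0 _ _ {{f≢0}} {{∏≢0 n f≢0}}

-- Bounds for the primorial
opaque
  θ : ℕ → ℕ
  θ x = ∏ x primePart

  θ-∏ : ∀ x → θ x ≡ ∏ x primePart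
  θ-∏ x = refl

  θ-suc : ∀ x → θ (suc x) ≡ primePart (suc x) * θ x
  θ-suc x = refl

instance
  θ≢0 : ∀ {x} → NonZero (θ x)
  θ≢0 {x} = subst NonZero (sym (θ-∏ x)) (∏≢0 x primePart≢0)

  K≢0 : NonZero K
  K≢0 = >-nonZero (<⇒≤ K≥2)

θ-≤-suc : ∀ x → θ x ≤ θ (suc x)
θ-≤-suc x = ≤-trans (m≤n*m (θ x) (primePart (suc x))) (≤-reflexive (sym (θ-suc x)))

θ-mono : ∀ {x y} → x ≤ y → θ x ≤ θ y
θ-mono = go ∘ ≤⇒≤′
  where
  go : ∀ {x y} → x ≤′ y → θ x ≤ θ y
  go ≤′-refl       = ≤-refl
  go (≤′-step x≤y) = ≤-trans (go x≤y) (θ-≤-suc _)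

θ-split : ∀ x y → θ x ≤ θ y * ∏[ p ≤ x ] (primePart p ^ ⟦ y <? p ⟧)
θ-split zero y = ≤-trans (θ-mono z≤n) (m≤m*n (θ y) 1)
θ-split (suc x) y = ⟦⟧-elim (λ e → θ (suc x) ≤ θ y * (primePart (suc x) ^ e * P)) (y <? suc x)
  (λ _ → begin
    θ (suc x)                          ≡⟨ θ-suc x ⟩
    primePart (suc x) * θ x            ≤⟨ *-monoʳ-≤ (primePart (suc x)) (θ-split x y) ⟩
    primePart (suc x) * (θ y * P)      ≡⟨ lemma (primePart (suc x)) (θ y) P ⟩
    θ y * (primePart (suc x) ^ 1 * P)  ∎)
  (λ y≮1+x → ≤-trans (θ-mono (≮⇒≥ y≮1+x)) (m≤m*n (θ y) (1 * P) {{m*n≢0 1 P {{_}} {{P≢0}}}}))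
  where
  open ≤-Reasoning
  P = ∏[ p ≤ x ] (primePart p ^ ⟦ y <? p ⟧)
  P≢0 : NonZero P
  P≢0 = ∏≢0 x λ {p} → m^n≢0 (primePart p) ⟦ y <? p ⟧
  lemma : ∀ a b c → a * (b * c) ≡ b * (a * 1 * c)
  lemma = solve-∀

denominator≢0 : ∀ N → NonZero (denominator N)
denominator≢0 N = m*n≢0 _ _ {{(15 * N) !* (10 * N) !≢0}} {{(6 * N) !≢0}}

-- The product of the primes in (5M, 30M] is at most the ratio, which is at most K^M.
θ[30M]≤ : ∀ M → θ (30 * M) ≤ θ (5 * M) * K ^ M
θ[30M]≤ M = ≤-trans (θ-split (30 * M) (5 * M)) (*-monoʳ-≤ (θ (5 * M))
  (*-cancelʳ-≤ _ _ (denominator M) {{denominator≢0 M}} (≤-trans (numerator-lower M) (numerator≤K^ M))))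

-- Ψ x = lcm (1, …, x) = e ^ ψ x.
Ψ : ℕ → ℕ
Ψ x = ∏[ p ≤ x ] (primePart p ^ ∑[ j ≤ x ] ⟦ primePart p ^ j ≤? x ⟧)

K^N≤Ψ : ∀ N → K ^ N ≤ (30 * N + 1) * Ψ (30 * N)
K^N≤Ψ N = *-cancelʳ-≤ _ _ (denominator N) {{denominator≢0 N}} (begin
  K ^ N * denominator N                            ≤⟨ K^≤numerator N ⟩
  (30 * N + 1) * numerator N                       ≤⟨ *-monoʳ-≤ (30 * N + 1) (numerator-upper N) ⟩
  (30 * N + 1) * (denominator N * Ψ (30 * N))      ≡⟨ lemma (30 * N + 1) (denominator N) (Ψ (30 * N)) ⟩
  (30 * N + 1) * Ψ (30 * N) * denominator N        ∎)
  where
  open ≤-Reasoning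
  lemma : ∀ a b c → a * (b * c) ≡ a * c * b
  lemma = solve-∀

∑-⟦⟧≤ : ∀ {P : ℕ → Set} (P? : ∀ i → Dec (P i)) n → ∑[ i ≤ n ] ⟦ P? i ⟧ ≤ n
∑-⟦⟧≤ P? zero    = z≤n
∑-⟦⟧≤ P? (suc n) = +-mono-≤ (⟦⟧-elim (_≤ 1) (P? (suc n)) (λ _ → ≤-refl) (λ _ → z≤n)) (∑-⟦⟧≤ P? n)

∑-⟦⟧≤1 : ∀ {P : ℕ → Set} (P? : ∀ i → Dec (P i)) → (∀ i → ¬ P (2 + i)) → ∀ n → ∑[ i ≤ n ] ⟦ P? i ⟧ ≤ 1
∑-⟦⟧≤1 P? ¬P zero          = z≤n
∑-⟦⟧≤1 P? ¬P (suc zero)    = ∑-⟦⟧≤ P? 1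
∑-⟦⟧≤1 P? ¬P (suc (suc n)) =
  subst (λ e → e + ∑[ i ≤ suc n ] ⟦ P? i ⟧ ≤ 1) (sym (⟦⟧-false (P? (2 + n)) (¬P n))) (∑-⟦⟧≤1 P? ¬P (suc n))

-- Peel off exponents from the top: once q^J ≤ x holds, at most `J` exponents are counted, so the
-- whole power is at most q^J.
q^∑≤ : ∀ q .{{_ : NonZero q}} x .{{_ : NonZero x}} J → q ^ ∑[ j ≤ J ] ⟦ q ^ j ≤? x ⟧ ≤ x
q^∑≤ q x zero    = >-nonZero⁻¹ x
q^∑≤ q x (suc J) = ⟦⟧-elim (λ e → q ^ (e + ∑[ j ≤ J ] ⟦ q ^ j ≤? x ⟧) ≤ x) (q ^ suc J ≤? x)
  (≤-trans (^-monoʳ-≤ q (s≤s (∑-⟦⟧≤ (λ j → q ^ j ≤? x) J))))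
  (λ _ → q^∑≤ q x J)

∏-initial : ∀ x .{{_ : NonZero x}} s n → ∏[ p ≤ n ] (x ^ ⟦ p ≤? s ⟧) ≤ x ^ (n ⊓ s)
∏-initial x s zero    = ≤-refl
∏-initial x s (suc n) = ⟦⟧-elim (λ e → x ^ e * P ≤ x ^ (suc n ⊓ s)) (suc n ≤? s)
  (λ n<s → begin
    x ^ 1 * P          ≤⟨ *-monoʳ-≤ (x ^ 1) (∏-initial x s n) ⟩
    x ^ 1 * x ^ (n ⊓ s) ≡⟨ cong₂ (λ a k → a * x ^ k) (*-identityʳ x) (m≤n⇒m⊓n≡m (<⇒≤ n<s)) ⟩
    x ^ suc n          ≡⟨ cong (x ^_) (m≤n⇒m⊓n≡m n<s) ⟨
    x ^ (suc n ⊓ s)    ∎)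
  (λ _ → begin
    1 * P              ≡⟨ *-identityˡ P ⟩
    P                  ≤⟨ ∏-initial x s n ⟩
    x ^ (n ⊓ s)        ≤⟨ ^-monoʳ-≤ x (⊓-monoˡ-≤ s (n≤1+n n)) ⟩
    x ^ (suc n ⊓ s)    ∎)
  where
  open ≤-Reasoning
  P = ∏[ p ≤ n ] (x ^ ⟦ p ≤? s ⟧)

-- A prime p ≤ s contributes a power of at most `x`. A prime p > s satisfies p² > x, so it
-- contributes only once, as in `θ x`.
Ψ≤θ : ∀ x .{{_ : NonZero x}} s → x < suc s * suc s → Ψ x ≤ x ^ s * θ x
Ψ≤θ x s x<s² = begin
  Ψ x                                                ≤⟨ ∏-mono x (λ {p} _ → factor p) ⟩
  ∏[ p ≤ x ] (x ^ ⟦ p ≤? s ⟧ * primePart p)          ≡⟨ ∏-* x _ _ ⟩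
  ∏[ p ≤ x ] (x ^ ⟦ p ≤? s ⟧) * ∏ x primePart        ≡⟨ cong (∏[ p ≤ x ] (x ^ ⟦ p ≤? s ⟧) *_) (θ-∏ x) ⟨
  ∏[ p ≤ x ] (x ^ ⟦ p ≤? s ⟧) * θ x                  ≤⟨ *-monoˡ-≤ (θ x) (≤-trans (∏-initial x s x)
                                                         (^-monoʳ-≤ x (m⊓n≤n x s))) ⟩
  x ^ s * θ x                                        ∎
  where
  open ≤-Reasoning
  e : ℕ → ℕ
  e q = ∑[ j ≤ x ] ⟦ q ^ j ≤? x ⟧
  factor : ∀ p → primePart p ^ e (primePart p) ≤ x ^ ⟦ p ≤? s ⟧ * primePart p
  factor p = ⟦⟧-elim (λ i → primePart p ^ e (primePart p) ≤ x ^ i * primePart p) (p ≤? s)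
    (λ _ → ≤-trans (q^∑≤ (primePart p) x x)
      (≤-trans (≤-reflexive (sym (*-identityʳ x))) (m≤m*n (x ^ 1) (primePart p))))
    (λ p≰s → begin
      primePart p ^ e (primePart p) ≤⟨ primePart^-mono p (λ pr → subst (λ q → e q ≤ 1) (sym (primePart-prime pr))
                                         (large pr (≰⇒> p≰s))) ⟩
      primePart p ^ 1               ≡⟨ *-comm (primePart p) 1 ⟩
      1 * primePart p               ∎)
    where
    large : Prime p → s < p → e p ≤ 1
    large pr s<p = ∑-⟦⟧≤1 (λ j → p ^ j ≤? x) (λ j p^j≤x → <⇒≱ x<s² (begin
      suc s * suc s  ≤⟨ *-mono-≤ s<p s<p ⟩
      p * p          ≡⟨ cong (p *_) (*-identityʳ p) ⟨
      p ^ 2          ≤⟨ ^-monoʳ-≤ p {{prime⇒nonZero pr}} (s≤s (s≤s (z≤n {j}))) ⟩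
      p ^ (2 + j)    ≤⟨ p^j≤x ⟩
      x              ∎)) x

-- Counting the primes of an interval through θ

#primesIn-suc : ∀ a b → #primesIn a (suc b) ≡ length (filter prime? (filter (a ≤?_) [ suc b ])) + #primesIn a b
#primesIn-suc a b = begin
  #primesIn a (suc b)
    ≡⟨ cong (λ l → length (filter prime? (filter (a ≤?_) l))) (upTo-∷ʳ (suc b)) ⟨
  length (filter prime? (filter (a ≤?_) (upTo (suc b) ++ [ suc b ])))
    ≡⟨ cong (length ∘ filter prime?) (filter-++ (a ≤?_) (upTo (suc b)) [ suc b ]) ⟩
  length (filter prime? (interval a b ++ filter (a ≤?_) [ suc b ]))
    ≡⟨ cong length (filter-++ prime? (interval a b) (filter (a ≤?_) [ suc b ])) ⟩
  length (primesIn a b ++ filter prime? (filter (a ≤?_) [ suc b ]))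
    ≡⟨ trans (length-++ (primesIn a b)) (+-comm (#primesIn a b) _) ⟩
  length (filter prime? (filter (a ≤?_) [ suc b ])) + #primesIn a b ∎
  where open ≡-Reasoning

primePart≤ : ∀ {B a b} .{{_ : NonZero B}} → a ≤ b → b ≤ B → primePart b ≤ B ^ length (filter prime? (filter (a ≤?_) [ b ]))
primePart≤ {B} {a} {b} a≤b b≤B with prime? b
... | no ¬pr = ≤-trans (≤-reflexive (primePart-¬prime ¬pr)) (m^n>0 B (length (filter prime? (filter (a ≤?_) [ b ]))))
... | yes pr = begin
  primePart b                                              ≡⟨ primePart-prime pr ⟩
  b                                                        ≤⟨ b≤B ⟩
  B                                                        ≡⟨ *-identityʳ B ⟨
  B ^ length [ b ]                                         ≡⟨ cong (λ l → B ^ length l) (filter-accept prime? pr) ⟨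
  B ^ length (filter prime? [ b ])                         ≡⟨ cong (λ l → B ^ length (filter prime? l)) (filter-accept (a ≤?_) a≤b) ⟨
  B ^ length (filter prime? (filter (a ≤?_) [ b ]))        ∎
  where open ≤-Reasoning

-- Passing from `a` to `b`, each new prime is at most `B` and is paid for by one factor `B`.
θ≤θ*^ : ∀ {B a b} .{{_ : NonZero B}} → a ≤′ b → b ≤ B → θ b ≤ θ a * B ^ #primesIn a b
-- The closed interval [a, a] contains one prime if `a` is prime; the additional factor only weakens
-- the bound.
θ≤θ*^ {B} {a} ≤′-refl _ = m≤m*n (θ a) (B ^ #primesIn a a) {{m^n≢0 B (#primesIn a a)}}
θ≤θ*^ {B} {a} {suc b} (≤′-step a≤b) b<B = begin
  θ (suc b)                                    ≡⟨ θ-suc b ⟩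
  primePart (suc b) * θ b                      ≤⟨ *-mono-≤ (primePart≤ (m≤n⇒m≤1+n (≤′⇒≤ a≤b)) b<B) (θ≤θ*^ a≤b (<⇒≤ b<B)) ⟩
  B ^ new * (θ a * B ^ #primesIn a b)          ≡⟨ lemma (B ^ new) (θ a) (B ^ #primesIn a b) ⟩
  θ a * (B ^ new * B ^ #primesIn a b)          ≡⟨ cong (θ a *_) (^-distribˡ-+-* B new (#primesIn a b)) ⟨
  θ a * B ^ (new + #primesIn a b)              ≡⟨ cong (λ k → θ a * B ^ k) (#primesIn-suc a b) ⟨
  θ a * B ^ #primesIn a (suc b)                ∎
  where
  open ≤-Reasoning
  new = length (filter prime? (filter (a ≤?_) [ suc b ]))
  lemma : ∀ x y z → x * (y * z) ≡ y * (x * z)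
  lemma = solve-∀

-- Comparison of θ(4n) with θ(5n).

-- The exponent 11 / 9 lies strictly between Chebyshev's 6 / 5 and the 5 / 4 needed later;
-- the slack absorbs the rounding in M ↦ ⌊M / 6⌋ + 1 once M ≥ 66.
θ-upper : ∀ C → θ (30 * 66) ^ 9 ≤ C → ∀ M → θ (30 * M) ^ 9 ≤ C * K ^ (11 * M)
θ-upper C base = <-rec (λ M → θ (30 * M) ^ 9 ≤ C * K ^ (11 * M)) step
  where
  open ≤-Reasoning
  step : ∀ M → (∀ {M′} → M′ < M → θ (30 * M′) ^ 9 ≤ C * K ^ (11 * M′)) → θ (30 * M) ^ 9 ≤ C * K ^ (11 * M)
  step M rec with 66 ≤? M
  ... | no 66≰M = begin
    θ (30 * M) ^ 9     ≤⟨ ^-monoˡ-≤ 9 (θ-mono (*-monoʳ-≤ 30 (≰⇒≥ 66≰M))) ⟩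
    θ (30 * 66) ^ 9    ≤⟨ base ⟩
    C                  ≤⟨ m≤m*n C (K ^ (11 * M)) {{m^n≢0 K (11 * M)}} ⟩
    C * K ^ (11 * M)   ∎
  ... | yes 66≤M = begin
    θ (30 * M) ^ 9                        ≤⟨ ^-monoˡ-≤ 9 (θ[30M]≤ M) ⟩
    (θ (5 * M) * K ^ M) ^ 9               ≤⟨ ^-monoˡ-≤ 9 (*-monoˡ-≤ (K ^ M) (θ-mono 5M≤30M′)) ⟩
    (θ (30 * M′) * K ^ M) ^ 9             ≡⟨ ^-* (θ (30 * M′)) (K ^ M) 9 ⟩
    θ (30 * M′) ^ 9 * (K ^ M) ^ 9         ≡⟨ cong (θ (30 * M′) ^ 9 *_) (^-*-assoc K M 9) ⟩
    θ (30 * M′) ^ 9 * K ^ (M * 9)         ≤⟨ *-monoˡ-≤ (K ^ (M * 9)) (rec M′<M) ⟩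
    C * K ^ (11 * M′) * K ^ (M * 9)       ≡⟨ *-assoc C (K ^ (11 * M′)) (K ^ (M * 9)) ⟩
    C * (K ^ (11 * M′) * K ^ (M * 9))     ≡⟨ cong (C *_) (^-distribˡ-+-* K (11 * M′) (M * 9)) ⟨
    C * K ^ (11 * M′ + M * 9)             ≤⟨ *-monoʳ-≤ C (^-monoʳ-≤ K (+-monoˡ-≤ (M * 9) 11M′≤2M)) ⟩
    C * K ^ (2 * M + M * 9)               ≡⟨ cong (λ e → C * K ^ e) (lemma₁ M) ⟩
    C * K ^ (11 * M)                      ∎
    where
    k  = M / 6
    M′ = suc k
    11≤k : 11 ≤ k
    11≤k = /-monoˡ-≤ 6 66≤M
    5M≤30M′ : 5 * M ≤ 30 * M′
    5M≤30M′ = begin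
      5 * M          ≤⟨ *-monoʳ-≤ 5 (<⇒≤ (m<1+m/n*n M 6)) ⟩
      5 * (M′ * 6)   ≡⟨ lemma₂ M′ ⟩
      30 * M′        ∎
      where
      lemma₂ : ∀ x → 5 * (x * 6) ≡ 30 * x
      lemma₂ = solve-∀
    -- The recursion closes if 11 M′ + 9 M ≤ 11 M. As 12 k ≤ 2 M, the 11 caused by rounding up fits
    -- into one spare `k`.
    11M′≤2M : 11 * M′ ≤ 2 * M
    11M′≤2M = begin
      11 * suc k     ≡⟨ *-suc 11 k ⟩
      11 + 11 * k    ≤⟨ +-monoˡ-≤ (11 * k) 11≤k ⟩
      k + 11 * k     ≡⟨ lemma₃ k ⟩
      2 * (k * 6)    ≤⟨ *-monoʳ-≤ 2 (m/n*n≤m M 6) ⟩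
      2 * M          ∎
      where
      lemma₃ : ∀ x → x + 11 * x ≡ 2 * (x * 6)
      lemma₃ = solve-∀
    M′<M : M′ < M
    M′<M = begin-strict
      1 + k    <⟨ +-monoˡ-< k (≤-trans (s≤s (s≤s z≤n)) 11≤k) ⟩
      k + k    ≡⟨ cong (k +_) (+-identityʳ k) ⟨
      2 * k    ≤⟨ *-monoˡ-≤ k (s≤s (s≤s (z≤n {4}))) ⟩
      6 * k    ≡⟨ *-comm 6 k ⟩
      k * 6    ≤⟨ m/n*n≤m M 6 ⟩
      M        ∎
    lemma₁ : ∀ x → 2 * x + x * 9 ≡ 11 * x
    lemma₁ = solve-∀

-- Lower bound at 150 u ≤ 5 n and upper bound at 120 (u + 1) ≥ 4 n, where u = ⌊n / 30⌋.
module _ (C : ℕ) (base : θ (30 * 66) ^ 9 ≤ C) (n B s : ℕ) (B≥ : 150 * suc (n / 30) ≤ B) where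
  private
    u = n / 30
    π = #primesIn (4 * n) (5 * n)
    n≤ : n ≤ 30 * suc u
    n≤ = ≤-trans (<⇒≤ (m<1+m/n*n n 30)) (≤-reflexive (*-comm (suc u) 30))
    5n≤B : 5 * n ≤ B
    5n≤B = ≤-trans (≤-trans (*-monoʳ-≤ 5 n≤) (≤-reflexive (sym (*-assoc 5 30 (suc u))))) B≥
    4n≤ : 4 * n ≤ 30 * (4 * suc u)
    4n≤ = ≤-trans (*-monoʳ-≤ 4 n≤) (≤-reflexive (lemma (suc u)))
      where
      lemma : ∀ x → 4 * (30 * x) ≡ 30 * (4 * x)
      lemma = solve-∀
    30N≤5n : 30 * (5 * u) ≤ 5 * n
    30N≤5n = ≤-trans (≤-reflexive (lemma u)) (*-monoʳ-≤ 5 (m/n*n≤m n 30))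
      where
      lemma : ∀ x → 30 * (5 * x) ≡ 5 * (x * 30)
      lemma = solve-∀
    30N+1≤B : 30 * (5 * u) + 1 ≤ B
    30N+1≤B = ≤-trans (≤-trans (+-monoʳ-≤ (30 * (5 * u)) (s≤s (z≤n {149}))) (≤-reflexive (lemma u))) B≥
      where
      lemma : ∀ x → 30 * (5 * x) + 150 ≡ 150 * suc x
      lemma = solve-∀
    instance
      B≢0 : NonZero B
      B≢0 = >-nonZero (≤-trans (m≤n+m 1 (30 * (5 * u))) 30N+1≤B)
    30N≤B : 30 * (5 * u) ≤ B
    30N≤B = ≤-trans (m≤m+n (30 * (5 * u)) 1) 30N+1≤B

  Ψ≤B^ : B ≤ s * s → Ψ (30 * (5 * u)) ≤ B ^ s * θ (5 * n)
  Ψ≤B^ B≤s² = bound (30 * (5 * u)) 30N≤B 30N≤5n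
    where
    bound : ∀ x → x ≤ B → x ≤ 5 * n → Ψ x ≤ B ^ s * θ (5 * n)
    -- The case u = 0, where `Ψ 0` is the empty product.
    bound zero x≤B x≤5n = *-mono-≤ (m^n>0 B s) (>-nonZero⁻¹ (θ (5 * n)))
    bound x@(suc _) x≤B x≤5n = ≤-trans
      (Ψ≤θ x s (≤-<-trans (≤-trans x≤B B≤s²) (*-mono-< (n<1+n s) (n<1+n s))))
      (*-mono-≤ (^-monoˡ-≤ s x≤B) (θ-mono x≤5n))

  -- After ninth powers the lower bound has exponent 45 u and the upper bound 44 (u + 1), so K^u
  -- remains up to the constant K^44.
  K^u≤ : B ≤ s * s → K ^ u ≤ K ^ 44 * C * B ^ ((1 + s + π) * 9)
  K^u≤ B≤s² = *-cancelʳ-≤ _ _ (K ^ (44 * suc u)) {{m^n≢0 K (44 * suc u)}} (begin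
    K ^ u * K ^ (44 * suc u)                   ≡⟨ ^-distribˡ-+-* K u (44 * suc u) ⟨
    K ^ (u + 44 * suc u)                       ≡⟨ cong (K ^_) (lemma₁ u) ⟩
    K ^ (44 + 5 * u * 9)                       ≡⟨ ^-distribˡ-+-* K 44 (5 * u * 9) ⟩
    K ^ 44 * K ^ (5 * u * 9)                   ≡⟨ cong (K ^ 44 *_) (^-*-assoc K (5 * u) 9) ⟨
    K ^ 44 * (K ^ (5 * u)) ^ 9                 ≤⟨ *-monoʳ-≤ (K ^ 44) (^-monoˡ-≤ 9 K^N≤) ⟩
    K ^ 44 * (B ^ e * θ (4 * n)) ^ 9           ≡⟨ cong (K ^ 44 *_) (^-* (B ^ e) (θ (4 * n)) 9) ⟩
    K ^ 44 * ((B ^ e) ^ 9 * θ (4 * n) ^ 9)     ≤⟨ *-monoʳ-≤ (K ^ 44) (*-monoʳ-≤ ((B ^ e) ^ 9) θ[4n]≤) ⟩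
    K ^ 44 * ((B ^ e) ^ 9 * (C * K ^ (44 * suc u)))
                                               ≡⟨ cong (λ b → K ^ 44 * (b * (C * K ^ (44 * suc u)))) (^-*-assoc B e 9) ⟩
    K ^ 44 * (B ^ (e * 9) * (C * K ^ (44 * suc u)))
                                               ≡⟨ lemma₂ (K ^ 44) (B ^ (e * 9)) C (K ^ (44 * suc u)) ⟩
    K ^ 44 * C * B ^ (e * 9) * K ^ (44 * suc u) ∎)
    where
    open ≤-Reasoning
    e = 1 + s + π
    lemma₁ : ∀ x → x + 44 * suc x ≡ 44 + 5 * x * 9
    lemma₁ = solve-∀
    lemma₂ : ∀ a b c d → a * (b * (c * d)) ≡ a * c * b * d
    lemma₂ = solve-∀
    lemma₃ : ∀ a b c d → a * (b * (c * d)) ≡ a * b * d * c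
    lemma₃ = solve-∀
    K^N≤ : K ^ (5 * u) ≤ B ^ e * θ (4 * n)
    K^N≤ = begin
      K ^ (5 * u)                             ≤⟨ K^N≤Ψ (5 * u) ⟩
      (30 * (5 * u) + 1) * Ψ (30 * (5 * u))   ≤⟨ *-mono-≤ 30N+1≤B (Ψ≤B^ B≤s²) ⟩
      B * (B ^ s * θ (5 * n))                 ≤⟨ *-monoʳ-≤ B (*-monoʳ-≤ (B ^ s)
                                                   (θ≤θ*^ (≤⇒≤′ (*-monoˡ-≤ n (s≤s (s≤s (s≤s (s≤s (z≤n {1}))))))) 5n≤B)) ⟩
      B * (B ^ s * (θ (4 * n) * B ^ π))       ≡⟨ lemma₃ B (B ^ s) (θ (4 * n)) (B ^ π) ⟩
      B ^ (1 + s) * B ^ π * θ (4 * n)         ≡⟨ cong (_* θ (4 * n)) (^-distribˡ-+-* B (1 + s) π) ⟨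
      B ^ e * θ (4 * n)                       ∎
    θ[4n]≤ : θ (4 * n) ^ 9 ≤ C * K ^ (44 * suc u)
    θ[4n]≤ = begin
      θ (4 * n) ^ 9                 ≤⟨ ^-monoˡ-≤ 9 (θ-mono 4n≤) ⟩
      θ (30 * (4 * suc u)) ^ 9      ≤⟨ θ-upper C base (4 * suc u) ⟩
      C * K ^ (11 * (4 * suc u))    ≡⟨ cong (λ k → C * K ^ k) (*-assoc 11 4 (suc u)) ⟨
      C * K ^ (44 * suc u)          ∎

-- Contradiction for large n.

-- Fourth roots make every term a polynomial in r: B ≤ z ^ 4 ≤ 2 ^ (4 z) and √B ≤ z ^ 2 with z
-- linear in r turn the bound on K ^ u into u = O(r ^ 3), against r ^ 4 ≤ u.
∃-fourthRoot : ∀ u → ∃[ r ] (r ^ 4 ≤ u × u < suc r ^ 4)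
∃-fourthRoot zero = 0 , z≤n , s≤s z≤n
∃-fourthRoot (suc u) with ∃-fourthRoot u
... | r , r⁴≤u , u<r⁴ with suc u <? suc r ^ 4
...   | yes 1+u<r⁴ = r , m≤n⇒m≤1+n r⁴≤u , 1+u<r⁴
...   | no  1+u≮r⁴ = suc r , ≮⇒≥ 1+u≮r⁴ , ≤-<-trans u<r⁴ (^-monoˡ-< 4 (n<1+n (suc r)))

150*1+u≤ : ∀ {u} w → u < w ^ 4 → 150 * suc u ≤ (4 * w) ^ 4
150*1+u≤ {u} w u<w⁴ = begin
  150 * suc u    ≤⟨ *-mono-≤ (≤ᵇ⇒≤ 150 256 _) u<w⁴ ⟩
  4 ^ 4 * w ^ 4  ≡⟨ ^-* 4 w 4 ⟨
  (4 * w) ^ 4    ∎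
  where open ≤-Reasoning

x⁴≡[x²]² : ∀ x → x ^ 4 ≡ x * x * (x * x)
x⁴≡[x²]² x = lemma x
  where
  lemma : ∀ x → x * (x * (x * (x * 1))) ≡ x * x * (x * x)
  lemma = solve-∀

-- Each term is at most its coefficient times r³. Here 288 = 8 · 4 · 9, and 65 = 8² + 1 collects the
-- square of 8 r and the summand 1.
cubic<quartic : ∀ C m r .{{_ : NonZero r}} {z k} → z ≤ r * 8 → k ≤ m → C + (m + 65) * 288 < r →
  C + z * 4 * ((1 + z * z + k) * 9) < r ^ 4
cubic<quartic C m r {z} {k} z≤8r k≤m c<r = begin-strict
  C + z * 4 * ((1 + z * z + k) * 9)
    ≤⟨ +-monoʳ-≤ C (*-mono-≤ (*-monoˡ-≤ 4 z≤8r)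
         (*-monoˡ-≤ 9 (+-mono-≤ (+-monoʳ-≤ 1 (*-mono-≤ z≤8r z≤8r)) k≤m))) ⟩
  C + r * 8 * 4 * ((1 + r * 8 * (r * 8) + m) * 9)
    ≡⟨ lemma₁ C r m ⟩
  C + r * (r * r * 64 + (m + 1)) * 288
    ≤⟨ +-mono-≤ (m≤m*n C (r * r * r)) (*-monoˡ-≤ 288 (*-monoʳ-≤ r (+-monoʳ-≤ (r * r * 64) (m≤n*m (m + 1) (r * r))))) ⟩
  C * (r * r * r) + r * (r * r * 64 + r * r * (m + 1)) * 288
    ≡⟨ lemma₂ C r m ⟩
  (C + (m + 65) * 288) * (r * r * r)
    <⟨ *-monoˡ-< (r * r * r) c<r ⟩
  r * (r * r * r)
    ≡⟨ lemma₃ r ⟩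
  r ^ 4 ∎
  where
  open ≤-Reasoning
  instance
    r²≢0 : NonZero (r * r)
    r²≢0 = m*n≢0 r r
    r³≢0 : NonZero (r * r * r)
    r³≢0 = m*n≢0 (r * r) r
  lemma₁ : ∀ C r m → C + r * 8 * 4 * ((1 + r * 8 * (r * 8) + m) * 9) ≡ C + r * (r * r * 64 + (m + 1)) * 288
  lemma₁ = solve-∀
  lemma₂ : ∀ C r m → C * (r * r * r) + r * (r * r * 64 + r * r * (m + 1)) * 288 ≡ (C + (m + 65) * 288) * (r * r * r)
  lemma₂ = solve-∀
  lemma₃ : ∀ r → r * (r * r * r) ≡ r * (r * (r * (r * 1)))
  lemma₃ = solve-∀

-- Everything is compared as a power of 2, using 2 ≤ K, C < 2^C and z < 2^z, so that the exponents
-- decide.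
K^u-large : ∀ C m u r .{{_ : NonZero r}} {B s z} k → z ≤ r * 8 → B ≤ z ^ 4 → s ≤ z * z → r ^ 4 ≤ u →
  k ≤ m → C + (m + 65) * 288 < r → ¬ K ^ u ≤ C * B ^ ((1 + s + k) * 9)
K^u-large C m u r {B} {s} {z} k z≤8r B≤z⁴ s≤z² r⁴≤u k≤m c<r K^u-small =
  <⇒≱ (^-monoʳ-< 2 ≤-refl (<-≤-trans (cubic<quartic C m r z≤8r k≤m c<r) r⁴≤u)) (begin
    2 ^ u                       ≤⟨ ^-monoˡ-≤ u K≥2 ⟩
    K ^ u                       ≤⟨ K^u-small ⟩
    C * B ^ E                   ≤⟨ *-mono-≤ (<⇒≤ (n<p^n ≤-refl C)) (^-monoˡ-≤ E B≤2^) ⟩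
    2 ^ C * (2 ^ (z * 4)) ^ E   ≡⟨ cong (2 ^ C *_) (^-*-assoc 2 (z * 4) E) ⟩
    2 ^ C * 2 ^ (z * 4 * E)     ≡⟨ ^-distribˡ-+-* 2 C (z * 4 * E) ⟨
    2 ^ (C + z * 4 * E)         ≤⟨ ^-monoʳ-≤ 2 (+-monoʳ-≤ C (*-monoʳ-≤ (z * 4)
                                     (*-monoˡ-≤ 9 (+-monoˡ-≤ k (+-monoʳ-≤ 1 s≤z²))))) ⟩
    2 ^ (C + z * 4 * ((1 + z * z + k) * 9)) ∎)
  where
  open ≤-Reasoning
  E = (1 + s + k) * 9
  B≤2^ : B ≤ 2 ^ (z * 4)
  B≤2^ = begin
    B            ≤⟨ B≤z⁴ ⟩
    z ^ 4        ≤⟨ ^-monoˡ-≤ 4 (<⇒≤ (n<p^n ≤-refl z)) ⟩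
    (2 ^ z) ^ 4  ≡⟨ ^-*-assoc 2 z 4 ⟩
    2 ^ (z * 4)  ∎

few-primes : ∀ C₀ → θ (30 * 66) ^ 9 ≤ C₀ → ∀ m n → #primesIn (4 * n) (5 * n) ≤ m →
  ¬ suc (K ^ 44 * C₀ + (m + 65) * 288) ^ 4 ≤ n / 30
few-primes C₀ base m n π≤m R⁴≤u = contra (∃-fourthRoot u)
  where
  u = n / 30
  C = K ^ 44 * C₀
  R = suc (C + (m + 65) * 288)
  contra : ¬ (∃[ r ] (r ^ 4 ≤ u × u < suc r ^ 4))
  -- With z = 4 (r + 1) the choices B = z^4 and s = z² make `s` the exact square root of `B`, and
  -- 150 ≤ 4^4 gives 150 (u + 1) ≤ B.
  contra (r , r⁴≤u , u<w⁴) = general (4 * w) ((4 * w) ^ 4) (4 * w * (4 * w))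
      z≤8r ≤-refl ≤-refl (≤-reflexive (x⁴≡[x²]² (4 * w))) (150*1+u≤ w u<w⁴)
    where
    w = suc r
    R≤r : R ≤ r
    R≤r = ≮⇒≥ λ r<R → <⇒≱ u<w⁴ (≤-trans (^-monoˡ-≤ 4 r<R) R⁴≤u)
    0<r : 0 < r
    0<r = ≤-trans (s≤s z≤n) R≤r
    z≤8r : 4 * suc r ≤ r * 8
    z≤8r = begin
      4 * (1 + r)     ≤⟨ *-monoʳ-≤ 4 (+-monoˡ-≤ r 0<r) ⟩
      4 * (r + r)     ≡⟨ lemma r ⟩
      r * 8           ∎
      where
      open ≤-Reasoning
      lemma : ∀ x → 4 * (x + x) ≡ x * 8
      lemma = solve-∀
    general : ∀ z B s → z ≤ r * 8 → B ≤ z ^ 4 → s ≤ z * z → B ≤ s * s → ¬ 150 * suc u ≤ B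
    general z B s z≤8r B≤z⁴ s≤z² B≤s² B≥ = K^u-large C m u r {{>-nonZero 0<r}}
      (#primesIn (4 * n) (5 * n)) z≤8r B≤z⁴ s≤z² r⁴≤u π≤m R≤r (K^u≤ C₀ base n B s B≥ B≤s²)

theorem4p0p2 : ∀ (m : ℕ) → m > 0 →
    ∃[ L ] (L > 0 × (∀ (n : ℕ) → n ≥ L → m ≤ #primesIn (4 * n) (5 * n)))
theorem4p0p2 m _ = R ^ 4 * 30 , *-mono-≤ (m^n>0 R 4) (s≤s (z≤n {29})) , λ n n≥L →
  ≮⇒≥ λ π<m → few-primes C₀ ≤-refl m n (<⇒≤ π<m)
    (subst (_≤ n / 30) (m*n/n≡m (R ^ 4) 30) (/-monoˡ-≤ 30 n≥L))
  where
  C₀ = θ (30 * 66) ^ 9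
  R = suc (K ^ 44 * C₀ + (m + 65) * 288)
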